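{- Let $C$ be a non-redundant sorting network on $n$ channels with depth $d$. Then every comparator $(i,j)$ in layer $d-1$ of $C$ satisfies $j-i\le 3$. Furthermore, if $j=i+2$, then $(i,i+1)$ or $(i+1,i+2)$ occurs in the last layer of $C$; and if $j=i+3$, then both $(i,i+1)$ and $(i+2,i+3)$ occur in the last layer of $C$.
   Context: A comparator network on $n$ channels is a finite sequence $C=L_1,\ldots,L_d$ of layers, where each layer is a non-empty set of pairs (comparators) $(i,j)$ with $1\le i<j\le n$, and any two distinct comparators in the same layer are disjoint as sets of channels; $d$ is its depth, and layer $k$ means $L_k$. Inputs are Boolean vectors $\vec x\in\{0,1\}^n$. The network acts by applying the layers in order: applying a layer interchanges the values on channels $i$ and $j$ for every comparator $(i,j)$ of the layer such that the current value on channel $i$ is larger than the one on channel $j$. $C(\vec x)$ denotes the output on $\vec x$. $C$ is a sorting network if $C(\vec x)$ is sorted in non-decreasing order for every $\vec x\in\{0,1\}^n$. A comparator $(i,j)$ in layer $L_k$ of $C$ is redundant if, for every input $\vec x\in\{0,1\}^n$, the value on channel $i$ just before layer $L_k$ is $\le$ the value on channel $j$ just before layer $L_k$. A sorting network with no redundant comparators is called non-redundant. -}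

module Defs where

open import Data.Bool using (Bool; if_then_else_; _≤_)
open import Data.Bool.Properties using (_<?_)
open import Data.Fin as Fin using (Fin; toℕ)
open import Data.Fin.Permutation.Components using (transpose)
open import Data.List using (List; []; foldl; length; lookup; take)
open import Data.List.Membership.Propositional using (_∈_)
open import Data.List.Relation.Unary.All using (All)
open import Data.List.Relation.Unary.AllPairs using (AllPairs)
open import Data.Nat using (ℕ; suc; pred)
open import Data.Product using (_×_; _,_; ∃)
open import Data.Vec.Functional using (Vector)
open import Function using (_∘_)
open import Relation.Binary.PropositionalEquality using (_≡_; _≢_)
open import Relation.Nullary using (¬_)
open import Relation.Nullary.Decidable using (⌊_⌋)

-- Channels are numbered from 0.
Pair : ℕ → Set
Pair n = Fin n × Fin n

Ordered : ∀ {n} → Pair n → Set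
Ordered (i , j) = i Fin.< j

Disjoint : ∀ {n} → Pair n → Pair n → Set
Disjoint (i , j) (k , l) = i ≢ k × i ≢ l × j ≢ k × j ≢ l

-- A set of comparators, listed in some order.  No pair is disjoint from
-- itself, so `disjoint` also rules out repetitions in the list.
record Layer (n : ℕ) : Set where
  field
    comparators : List (Pair n)
    nonEmpty    : comparators ≢ []
    ordered     : All Ordered comparators
    disjoint    : AllPairs Disjoint comparators

open Layer public

Network : ℕ → Set
Network n = List (Layer n)

depth : ∀ {n} → Network n → ℕ
depth = length

-- Layers are numbered from 1, so nothing occurs in layer 0 or in a layer
-- beyond the depth.
OccursIn : ∀ {n} → Network n → ℕ → Pair n → Set
OccursIn C k c =
  ∃ λ (m : Fin (depth C)) → suc (toℕ m) ≡ k × c ∈ comparators (lookup C m)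

applyComparator : ∀ {n} → Vector Bool n → Pair n → Vector Bool n
applyComparator x (i , j) = if ⌊ x j <? x i ⌋ then x ∘ transpose i j else x

-- The comparators of a layer are disjoint, so applying them one after the
-- other, in any order, has the same effect as applying them simultaneously.
applyLayer : ∀ {n} → Vector Bool n → Layer n → Vector Bool n
applyLayer x L = foldl applyComparator x (comparators L)

run : ∀ {n} → Network n → Vector Bool n → Vector Bool n
run C x = foldl applyLayer x C

Sorted : ∀ {n} → Vector Bool n → Set
Sorted x = ∀ i j → i Fin.≤ j → x i ≤ x j

IsSortingNetwork : ∀ {n} → Network n → Set
IsSortingNetwork C = ∀ x → Sorted (run C x)

valuesBefore : ∀ {n} → Network n → ℕ → Vector Bool n → Vector Bool n
valuesBefore C k x = run (take (pred k) C) x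

Redundant : ∀ {n} → Network n → ℕ → Pair n → Set
Redundant C k (i , j) = ∀ x → valuesBefore C k x i ≤ valuesBefore C k x j

NonRedundant : ∀ {n} → Network n → Set
NonRedundant C = ∀ k c → OccursIn C k c → ¬ Redundant C k c

{-# OPTIONS --safe #-}

-- Let i and j be compared in some layer, and suppose that for two consecutive
-- numbers m, m + 1 of zeros in the input the two channels always carry distinct
-- values just before that layer.  Runs are monotone, so raising one input bit
-- within these two levels can change neither value; any two inputs with m zeros
-- are linked by such moves, and one of them is sorted, so on all of them channel
-- i carries 0 and channel j carries 1.  Every other input is comparable to one
-- with m zeros, hence never gives (1, 0), and the comparator is redundant.  Since
-- the number of zeros determines the output, distinctness does hold when channel m
-- lies strictly between the channels reachable from i and those reachable from j.
-- In the last layer this forces j = i + 1, so before it at most i + 1 is reachable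
-- from i and at least j - 1 from j.
module Submission where

open import Defs
open import Data.Bool as Bool using (Bool; true; false; _∧_; _∨_; f≤t; b≤b)
open import Data.Bool.Properties as Boolₚ using (_<?_)
open import Data.Empty using (⊥; ⊥-elim)
open import Data.Fin as Fin using (Fin; toℕ; zero; suc; fromℕ<)
open import Data.Fin.Permutation as Perm using ()
open import Data.Fin.Permutation.Components using (transpose)
open import Data.Fin.Properties using (toℕ-fromℕ<; toℕ-injective; toℕ<n)
open import Data.List using (List; []; _∷_; _++_; _∷ʳ_; length; foldl; take)
import Data.List.Membership.DecPropositional as DecMembership
open import Data.List.Membership.Propositional using (_∈_)
open import Data.List.Properties using (foldl-++; ++-assoc; length-++)
open import Data.List.Relation.Unary.All as All using (All; []; _∷_)
open import Data.List.Relation.Unary.AllPairs using (AllPairs; []; _∷_)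
open import Data.List.Relation.Unary.Any using (here; there)
open import Data.Nat using (ℕ; zero; suc; _+_; _∸_; _≤_; _<_; z≤n; s≤s; s≤s⁻¹; _≤?_)
open import Data.Nat.Properties as ℕₚ using (+-0-commutativeMonoid)
open import Data.Product using (_×_; _,_; ∃; proj₁; proj₂)
open import Data.Product.Properties using (≡-dec)
open import Data.Sum using (_⊎_; inj₁; inj₂)
open import Data.Vec.Functional as V using (Vector)
open import Function using (_∘_)
open import Relation.Binary.PropositionalEquality using (_≡_; _≢_; refl; sym; trans; cong; cong₂; subst; subst₂)
open import Relation.Nullary using (¬_; Dec; yes; no; contradiction)
open import Algebra.Properties.CommutativeMonoid.Sum +-0-commutativeMonoid using (sum; sum-permute)

-- Boolean vectors: pointwise order and number of zeros

private
  variable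
    n : ℕ

_≤ᵛ_ : Vector Bool n → Vector Bool n → Set
x ≤ᵛ y = ∀ p → x p Bool.≤ y p

∷-mono : ∀ {b c} {x y : Vector Bool n} → b Bool.≤ c → x ≤ᵛ y → (b V.∷ x) ≤ᵛ (c V.∷ y)
∷-mono b≤c x≤y zero    = b≤c
∷-mono b≤c x≤y (suc p) = x≤y p

-- A vector agrees with its head and tail put back together only pointwise, so passing from one to
-- the other is done by comparisons in both directions.
≤-η : (x : Vector Bool (suc n)) → x ≤ᵛ (x zero V.∷ V.tail x)
≤-η x zero    = b≤b
≤-η x (suc p) = b≤b

η-≤ : (x : Vector Bool (suc n)) → (x zero V.∷ V.tail x) ≤ᵛ x
η-≤ x zero    = b≤b
η-≤ x (suc p) = b≤b

≤-true : ∀ {b c} → b Bool.≤ c → b ≡ true → c ≡ true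
≤-true b≤b refl = refl

≤-false : ∀ {b c} → b Bool.≤ c → c ≡ false → b ≡ false
≤-false b≤b refl = refl

true≢false : ∀ {b} → b ≡ true → b ≢ false
true≢false refl ()

isZero : Bool → ℕ
isZero true  = 0
isZero false = 1

zeros : Vector Bool n → ℕ
zeros x = sum (isZero ∘ x)

isZero-antitone : ∀ {b c} → b Bool.≤ c → isZero c ≤ isZero b
isZero-antitone f≤t = z≤n
isZero-antitone b≤b = ℕₚ.≤-refl

zeros-antitone : {x y : Vector Bool n} → x ≤ᵛ y → zeros y ≤ zeros x
zeros-antitone {zero}  x≤y = z≤n
zeros-antitone {suc n} x≤y = ℕₚ.+-mono-≤ (isZero-antitone (x≤y zero)) (zeros-antitone (x≤y ∘ suc))

sorted-tail : {x : Vector Bool (suc n)} → Sorted x → Sorted (V.tail x)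
sorted-tail s i j i≤j = s (suc i) (suc j) (s≤s i≤j)

sorted-false⇒< : {x : Vector Bool n} → Sorted x → ∀ p → x p ≡ false → toℕ p < zeros x
sorted-false⇒< {x = x} s zero eq rewrite eq = s≤s z≤n
sorted-false⇒< {x = x} s (suc p) eq
  rewrite ≤-false (s zero (suc p) z≤n) eq = s≤s (sorted-false⇒< (sorted-tail s) p eq)

sorted-true⇒≤ : {x : Vector Bool n} → Sorted x → ∀ p → x p ≡ true → zeros x ≤ toℕ p
sorted-true⇒≤ {suc zero}    s zero eq rewrite eq = z≤n
sorted-true⇒≤ {suc (suc n)} s zero eq
  with tail≤ ← sorted-true⇒≤ (sorted-tail s) zero (≤-true (s zero (suc zero) z≤n) eq)
  rewrite eq = tail≤
sorted-true⇒≤ {suc n} {x} s (suc p) eq with x zero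
... | true  = ℕₚ.m≤n⇒m≤1+n (sorted-true⇒≤ (sorted-tail s) p eq)
... | false = s≤s (sorted-true⇒≤ (sorted-tail s) p eq)

sorted-< : {x : Vector Bool n} → Sorted x → ∀ p → toℕ p < zeros x → x p ≡ false
sorted-< {x = x} s p p<z with x p in eq
... | false = refl
... | true  = contradiction (sorted-true⇒≤ s p eq) (ℕₚ.<⇒≱ p<z)

sorted-≥ : {x : Vector Bool n} → Sorted x → ∀ p → zeros x ≤ toℕ p → x p ≡ true
sorted-≥ {x = x} s p z≤p with x p in eq
... | true  = refl
... | false = contradiction z≤p (ℕₚ.<⇒≱ (sorted-false⇒< s p eq))

-- Provides a base point on each level: networks fix sorted inputs, so its run is known.
sorted-with-zeros : ∀ {m} → m ≤ n → ∃ λ (x : Vector Bool n) → Sorted x × zeros x ≡ m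
sorted-with-zeros {zero}  z≤n = (λ ()) , (λ ()) , refl
sorted-with-zeros {suc n} z≤n with sorted-with-zeros {n} z≤n
... | x , s , z = true V.∷ x , sorted , z
  where
  sorted : Sorted (true V.∷ x)
  sorted zero    zero    _         = b≤b
  sorted zero    (suc j) _         = Boolₚ.≤-reflexive (sym (sorted-≥ s j (subst (_≤ toℕ j) (sym z) z≤n)))
  sorted (suc i) (suc j) (s≤s i≤j) = s i j i≤j
sorted-with-zeros (s≤s m≤n) with sorted-with-zeros m≤n
... | x , s , z = false V.∷ x , sorted , cong suc z
  where
  sorted : Sorted (false V.∷ x)
  sorted zero    j       _         = Boolₚ.≤-minimum _
  sorted (suc i) (suc j) (s≤s i≤j) = s i j i≤j

-- Moving between levels, and connectedness of one level

raise : ∀ {m} (x : Vector Bool n) → m ≤ zeros x → ∃ λ y → x ≤ᵛ y × zeros y ≡ m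
raise {zero} x z≤n = x , (λ _ → b≤b) , refl
raise {suc n} {m} x m≤z with x zero in eq
... | true with raise (V.tail x) m≤z
...   | y , x≤y , z = true V.∷ y , (λ { zero → Boolₚ.≤-maximum _ ; (suc p) → x≤y p }) , z
raise {suc n} {m} x m≤z | false with m ≤? zeros (V.tail x)
-- The head is 0 and the tail has fewer than `m` zeros, so `x` already has exactly `m` and nothing
-- is raised.
... | no m≰ = x , (λ _ → b≤b) , trans (cong (λ b → isZero b + zeros (V.tail x)) eq) (ℕₚ.≤-antisym (ℕₚ.≰⇒> m≰) m≤z)
... | yes m≤ with raise (V.tail x) m≤
...   | y , x≤y , z = true V.∷ y , (λ { zero → Boolₚ.≤-maximum _ ; (suc p) → x≤y p }) , z

lower : ∀ {m} (x : Vector Bool n) → zeros x ≤ m → m ≤ n → ∃ λ y → y ≤ᵛ x × zeros y ≡ m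
lower {zero} x z≤m z≤n = x , (λ _ → b≤b) , refl
lower {suc n} {zero} x z≤m m≤n = x , (λ _ → b≤b) , ℕₚ.n≤0⇒n≡0 z≤m
lower {suc n} {suc m} x z≤m m≤n with zeros (V.tail x) ≤? m
... | no z≰m = x , (λ _ → b≤b) ,
      ℕₚ.≤-antisym z≤m (ℕₚ.≤-trans (ℕₚ.≰⇒> z≰m) (ℕₚ.m≤n+m _ (isZero (x zero))))
... | yes tz≤m with lower (V.tail x) tz≤m (s≤s⁻¹ m≤n)
...   | y , y≤x , z = false V.∷ y , (λ { zero → Boolₚ.≤-minimum _ ; (suc p) → y≤x p }) , cong suc z

-- As `zeros` is antitone, the two bounds place both `x` and `y` on the levels `m` and `m + 1`.
InvariantBetween : ℕ → (Vector Bool n → Set) → Set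
InvariantBetween m P =
  ∀ {x y} → x ≤ᵛ y → zeros x ≤ suc m → m ≤ zeros y → (P x → P y) × (P y → P x)

-- Inputs with m zeros whose first bits differ are linked through inputs that
-- start with 0, by raising the tail of one of them.
level-connected : ∀ {n m} {P : Vector Bool n → Set} → InvariantBetween m P →
                  ∀ {x y} → zeros x ≡ m → zeros y ≡ m → P x → P y
level-connected-0∷ : ∀ {n m} {P : Vector Bool (suc n) → Set} → InvariantBetween m P →
                     ∀ {x y} → zeros (false V.∷ x) ≡ m → zeros (false V.∷ y) ≡ m →
                     P (false V.∷ x) → P (false V.∷ y)
level-connected-∷ : ∀ {n m} {P : Vector Bool (suc n) → Set} → InvariantBetween m P →
                    ∀ b c {x y} → zeros (b V.∷ x) ≡ m → zeros (c V.∷ y) ≡ m → P (b V.∷ x) → P (c V.∷ y)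

level-connected {zero} inv {x} {y} zx refl = proj₁ (inv (λ ()) (ℕₚ.m≤n⇒m≤1+n (ℕₚ.≤-reflexive zx)) ℕₚ.≤-refl)
level-connected {suc n} inv {x} {y} refl zy Px =
  proj₁ (inv (η-≤ y) (ℕₚ.m≤n⇒m≤1+n (ℕₚ.≤-reflexive zy)) (ℕₚ.≤-reflexive (sym zy)))
    (level-connected-∷ inv (x zero) (y zero) refl zy
      (proj₁ (inv (≤-η x) (ℕₚ.n≤1+n _) ℕₚ.≤-refl) Px))

-- The leading 0 accounts for one zero, so the tails are linked one level lower.
level-connected-0∷ {P = P} inv refl zy =
  level-connected {P = P ∘ (false V.∷_)}
    (λ x≤y zx≤ ≤zy → inv (∷-mono b≤b x≤y) (s≤s zx≤) (s≤s ≤zy)) refl (ℕₚ.suc-injective zy)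

level-connected-∷ {P = P} inv true true =
  level-connected {P = P ∘ (true V.∷_)} λ x≤y → inv (∷-mono b≤b x≤y)
level-connected-∷ inv false false = level-connected-0∷ inv
-- The route leaves level `m` once: clearing the first bit gives `m + 1` zeros, and raising the tail
-- from `x` to `z` returns to `m`.
level-connected-∷ inv true false {x} {y} zx refl Px
  with z , x≤z , zz ← raise x (ℕₚ.≤-trans (ℕₚ.n≤1+n (zeros y)) (ℕₚ.≤-reflexive (sym zx))) =
  level-connected-0∷ inv (cong suc zz) refl
    (proj₁ (inv (∷-mono b≤b x≤z) (s≤s (ℕₚ.≤-reflexive zx)) (ℕₚ.≤-reflexive (cong suc (sym zz))))
      (proj₂ (inv (∷-mono f≤t (λ _ → b≤b)) (s≤s (ℕₚ.≤-reflexive zx)) (ℕₚ.≤-reflexive (sym zx))) Px))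
level-connected-∷ inv false true {x} {y} refl zy Px
  with z , y≤z , zz ← raise y (ℕₚ.≤-trans (ℕₚ.n≤1+n (zeros x)) (ℕₚ.≤-reflexive (sym zy))) =
  proj₁ (inv (∷-mono f≤t (λ _ → b≤b)) (s≤s (ℕₚ.≤-reflexive zy)) (ℕₚ.≤-reflexive (sym zy)))
    (proj₂ (inv (∷-mono b≤b y≤z) (s≤s (ℕₚ.≤-reflexive zy)) (ℕₚ.≤-reflexive (cong suc (sym zz))))
      (level-connected-0∷ inv refl (cong suc zz) Px))

-- The effect of a single comparator

transpose-left : (i j : Fin n) → transpose i j i ≡ j
transpose-left i j with i Fin.≟ i
... | yes _  = refl
... | no i≢i = contradiction refl i≢i

transpose-right : (i j : Fin n) → transpose i j j ≡ i
transpose-right i j with j Fin.≟ i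
... | yes j≡i = j≡i
... | no _ with j Fin.≟ j
...   | yes _  = refl
...   | no j≢j = contradiction refl j≢j

transpose-other : ∀ {i j p : Fin n} → p ≢ i → p ≢ j → transpose i j p ≡ p
transpose-other {i = i} {j} {p} p≢i p≢j with p Fin.≟ i
... | yes p≡i = contradiction p≡i p≢i
... | no _ with p Fin.≟ j
...   | yes p≡j = contradiction p≡j p≢j
...   | no _    = refl

-- On bits `∧` is the minimum and `∨` the maximum; monotonicity of a comparator thus reduces to that
-- of these two operations.
comparator-left : (x : Vector Bool n) (i j : Fin n) → applyComparator x (i , j) i ≡ x i ∧ x j
comparator-left x i j with x i in xi | x j in xj
... | false | false = xi
... | false | true  = xi
... | true  | false = trans (cong x (transpose-left i j)) xj
... | true  | true  = xi

comparator-right : (x : Vector Bool n) (i j : Fin n) → applyComparator x (i , j) j ≡ x i ∨ x j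
comparator-right x i j with x i in xi | x j in xj
... | false | false = xj
... | false | true  = xj
... | true  | false = trans (cong x (transpose-right i j)) xi
... | true  | true  = xj

comparator-other : (x : Vector Bool n) {i j p : Fin n} → p ≢ i → p ≢ j → applyComparator x (i , j) p ≡ x p
comparator-other x {i} {j} p≢i p≢j with x j <? x i
... | yes _ = cong x (transpose-other p≢i p≢j)
... | no _  = refl

-- Monotonicity, conservation of zeros, and sorted inputs

∧-mono : ∀ {b b′ c c′} → b Bool.≤ b′ → c Bool.≤ c′ → b ∧ c Bool.≤ b′ ∧ c′
∧-mono f≤t         _   = Boolₚ.≤-minimum _
∧-mono {false} b≤b _   = b≤b
∧-mono {true}  b≤b c≤ = c≤

∨-mono : ∀ {b b′ c c′} → b Bool.≤ b′ → c Bool.≤ c′ → b ∨ c Bool.≤ b′ ∨ c′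
∨-mono f≤t         _   = Boolₚ.≤-maximum _
∨-mono {false} b≤b c≤ = c≤
∨-mono {true}  b≤b _   = b≤b

comparator-mono : ∀ c {x y : Vector Bool n} → x ≤ᵛ y → applyComparator x c ≤ᵛ applyComparator y c
comparator-mono (i , j) {x} {y} x≤y p with p Fin.≟ i
... | yes refl = subst₂ Bool._≤_ (sym (comparator-left x p j)) (sym (comparator-left y p j)) (∧-mono (x≤y p) (x≤y j))
... | no p≢i with p Fin.≟ j
...   | yes refl = subst₂ Bool._≤_ (sym (comparator-right x i p)) (sym (comparator-right y i p)) (∨-mono (x≤y i) (x≤y p))
...   | no p≢j = subst₂ Bool._≤_ (sym (comparator-other x p≢i p≢j)) (sym (comparator-other y p≢i p≢j)) (x≤y p)

comparators-mono : ∀ cs {x y : Vector Bool n} → x ≤ᵛ y → foldl applyComparator x cs ≤ᵛ foldl applyComparator y cs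
comparators-mono []       x≤y = x≤y
comparators-mono (c ∷ cs) x≤y = comparators-mono cs (comparator-mono c x≤y)

run-mono : ∀ (C : Network n) {x y} → x ≤ᵛ y → run C x ≤ᵛ run C y
run-mono []      x≤y = x≤y
run-mono (L ∷ C) x≤y = run-mono C (comparators-mono (comparators L) x≤y)

zeros-comparator : ∀ (x : Vector Bool n) c → zeros (applyComparator x c) ≡ zeros x
zeros-comparator x (i , j) with x j <? x i
... | yes _ = sym (sum-permute (isZero ∘ x) (Perm.transpose i j))
... | no _  = refl

zeros-comparators : ∀ (x : Vector Bool n) cs → zeros (foldl applyComparator x cs) ≡ zeros x
zeros-comparators x []       = refl
zeros-comparators x (c ∷ cs) = trans (zeros-comparators (applyComparator x c) cs) (zeros-comparator x c)

zeros-run : ∀ (C : Network n) x → zeros (run C x) ≡ zeros x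
zeros-run []      x = refl
zeros-run (L ∷ C) x = trans (zeros-run C (applyLayer x L)) (zeros-comparators x (comparators L))

-- No exchange happens, so the result is `x` itself as a function, and `cong` carries the equality
-- through all later comparators and layers.
comparator-sorted : ∀ {x : Vector Bool n} {c} → Sorted x → Ordered c → applyComparator x c ≡ x
comparator-sorted {x = x} {i , j} s i<j with x j | x i | s i j (ℕₚ.<⇒≤ i<j)
... | false | false | _ = refl
... | true  | false | _ = refl
... | true  | true  | _ = refl

comparators-sorted : ∀ {x : Vector Bool n} {cs} → Sorted x → All Ordered cs → foldl applyComparator x cs ≡ x
comparators-sorted s [] = refl
comparators-sorted {cs = _ ∷ cs} s (o ∷ os) =
  trans (cong (λ y → foldl applyComparator y cs) (comparator-sorted s o)) (comparators-sorted s os)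

run-sorted : ∀ (C : Network n) {x} → Sorted x → run C x ≡ x
run-sorted []      s = refl
run-sorted (L ∷ C) s = trans (cong (run C) (comparators-sorted s (ordered L))) (run-sorted C s)

-- The effect of a layer on one channel

comparators-other : ∀ (x : Vector Bool n) {p cs} → All (λ (i , j) → p ≢ i × p ≢ j) cs →
                    foldl applyComparator x cs p ≡ x p
comparators-other x []                           = refl
comparators-other x {cs = c ∷ _} ((p≢i , p≢j) ∷ ps) =
  trans (comparators-other (applyComparator x c) ps) (comparator-other x p≢i p≢j)

-- By disjointness no other comparator of the list touches `i` or `j`, so the position of `(i , j)`
-- in the list does not matter.
comparators-∈ : ∀ (x : Vector Bool n) {cs i j} → AllPairs Disjoint cs → (i , j) ∈ cs →
                foldl applyComparator x cs i ≡ x i ∧ x j × foldl applyComparator x cs j ≡ x i ∨ x j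
comparators-∈ x {i = i} {j} (ds ∷ _) (here refl) =
  trans (comparators-other _ (All.map (λ (i≢k , i≢l , _) → i≢k , i≢l) ds)) (comparator-left x i j) ,
  trans (comparators-other _ (All.map (λ (_ , _ , j≢k , j≢l) → j≢k , j≢l) ds)) (comparator-right x i j)
comparators-∈ x {c ∷ cs} (d ∷ ds) (there c∈cs)
  with k≢i , k≢j , l≢i , l≢j ← All.lookup d c∈cs
  with left , right ← comparators-∈ (applyComparator x c) ds c∈cs
  with xi ← comparator-other x (k≢i ∘ sym) (l≢i ∘ sym)
     | xj ← comparator-other x (k≢j ∘ sym) (l≢j ∘ sym) =
  trans left (cong₂ _∧_ xi xj) , trans right (cong₂ _∨_ xi xj)

data Role (p : Fin n) (cs : List (Pair n)) : Set where
  lower-end : ∀ q → (p , q) ∈ cs → Role p cs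
  upper-end : ∀ q → (q , p) ∈ cs → Role p cs
  unused    : All (λ (i , j) → p ≢ i × p ≢ j) cs → Role p cs

role : ∀ (p : Fin n) cs → Role p cs
role p [] = unused []
role p ((i , j) ∷ cs) with p Fin.≟ i | p Fin.≟ j | role p cs
... | yes refl | _        | _               = lower-end j (here refl)
... | no _     | yes refl | _               = upper-end i (here refl)
... | no _     | no _     | lower-end q q∈ = lower-end q (there q∈)
... | no _     | no _     | upper-end q q∈ = upper-end q (there q∈)
... | no p≢i   | no p≢j   | unused ps       = unused ((p≢i , p≢j) ∷ ps)

-- A 1 on the smaller channel of a comparator forces a 1 on the larger one; on any other channel it
-- stays. So a 1 can be followed through the layer without knowing the partner's value.
-- `layer-false` is the dual for 0.
layer-true : ∀ (L : Layer n) x {p} → x p ≡ true →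
             ∃ λ q → (q ≡ p ⊎ (p , q) ∈ comparators L) × applyLayer x L q ≡ true
layer-true L x {p} xp with role p (comparators L)
... | lower-end q q∈ = q , inj₂ q∈ , trans (proj₂ (comparators-∈ x (disjoint L) q∈)) (cong (_∨ x q) xp)
... | upper-end q q∈ = p , inj₁ refl ,
      trans (proj₂ (comparators-∈ x (disjoint L) q∈)) (trans (cong (x q ∨_) xp) (Boolₚ.∨-zeroʳ (x q)))
... | unused ps = p , inj₁ refl , trans (comparators-other x ps) xp

layer-false : ∀ (L : Layer n) x {p} → x p ≡ false →
              ∃ λ q → (q ≡ p ⊎ (q , p) ∈ comparators L) × applyLayer x L q ≡ false
layer-false L x {p} xp with role p (comparators L)
... | upper-end q q∈ = q , inj₂ q∈ ,
      trans (proj₁ (comparators-∈ x (disjoint L) q∈)) (trans (cong (x q ∧_) xp) (Boolₚ.∧-zeroʳ (x q)))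
... | lower-end q q∈ = p , inj₁ refl , trans (proj₁ (comparators-∈ x (disjoint L) q∈)) (cong (_∧ x q) xp)
... | unused ps = p , inj₁ refl , trans (comparators-other x ps) xp

-- The criterion for redundancy

≢⇒true : ∀ {b c} → b ≢ c → b ≡ false → c ≡ true
≢⇒true {c = false} b≢c refl = contradiction refl b≢c
≢⇒true {c = true}  b≢c refl = refl

≢⇒false : ∀ {b c} → b ≢ c → c ≡ true → b ≡ false
≢⇒false {false} b≢c refl = refl
≢⇒false {true}  b≢c refl = contradiction refl b≢c

≤∧≢⇒false : ∀ {b c} → b Bool.≤ c → b ≢ c → b ≡ false
≤∧≢⇒false f≤t b≢c = refl
≤∧≢⇒false b≤b b≢c = contradiction refl b≢c

distinct⇒≤ : ∀ (A : Network n) {i j m} → i Fin.< j → m ≤ n →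
             (∀ x → m ≤ zeros x → zeros x ≤ suc m → run A x i ≢ run A x j) →
             ∀ x → run A x i Bool.≤ run A x j
distinct⇒≤ {n} A {i} {j} {m} i<j m≤n distinct x
  with ℕₚ.≤-total (zeros x) m | sorted-with-zeros m≤n
... | z≤m⊎m≤z | s , sorted , zs = compare z≤m⊎m≤z
  where
  invariant : InvariantBetween m (λ y → run A y i ≡ false)
  invariant {y} {z} y≤z zy≤ ≤zz = up , ≤-false (run-mono A y≤z i)
    where
    ≤zy : m ≤ zeros y
    ≤zy = ℕₚ.≤-trans ≤zz (zeros-antitone y≤z)
    zz≤ : zeros z ≤ suc m
    zz≤ = ℕₚ.≤-trans (zeros-antitone y≤z) zy≤
    -- Raising keeps the 1 on channel `j`, hence by distinctness the 0 on channel `i`.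
    up : run A y i ≡ false → run A z i ≡ false
    up yi = ≢⇒false (distinct z ≤zz zz≤) (≤-true (run-mono A y≤z j) (≢⇒true (distinct y ≤zy zy≤) yi))
  -- The sorted `s` passes through `A` unchanged, so `i < j` orders its two values, and distinctness
  -- makes them 0 and 1.
  si : run A s i ≡ false
  si = ≤∧≢⇒false
    (subst (λ y → y i Bool.≤ y j) (sym (run-sorted A sorted)) (sorted i j (ℕₚ.<⇒≤ i<j)))
    (distinct s (ℕₚ.≤-reflexive (sym zs)) (ℕₚ.m≤n⇒m≤1+n (ℕₚ.≤-reflexive zs)))
  level : ∀ y → zeros y ≡ m → run A y i ≡ false
  level y zy = level-connected invariant zs zy si
  compare : zeros x ≤ m ⊎ m ≤ zeros x → run A x i Bool.≤ run A x j
  -- An input with at most `m` zeros lies above some `y` on level `m`, from which channel `j`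
  -- inherits its 1.
  compare (inj₁ z≤m) with y , y≤x , refl ← lower x z≤m m≤n =
    subst (run A x i Bool.≤_)
      (sym (≤-true (run-mono A y≤x j) (≢⇒true (distinct y ℕₚ.≤-refl (ℕₚ.n≤1+n _)) (level y refl))))
      (Boolₚ.≤-maximum _)
  -- Dually, `x` lies below such a `y`, from which channel `i` inherits its 0.
  compare (inj₂ m≤z) with y , x≤y , zy ← raise x m≤z =
    subst (Bool._≤ run A x j) (sym (≤-false (run-mono A x≤y i) (level y zy))) (Boolₚ.≤-minimum _)

-- Equal values pass a comparator unchanged: two 1s leave a 1 on `i`, two 0s a 0 on `j`. Excluding
-- both after the layer makes the values before it distinct.
distinct-after⇒≤ : ∀ (A : Network n) (L : Layer n) {i j m} → (i , j) ∈ comparators L → m ≤ n →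
                   (∀ x → m ≤ zeros x → zeros x ≤ suc m →
                     ¬ (applyLayer (run A x) L i ≡ true) × ¬ (applyLayer (run A x) L j ≡ false)) →
                   ∀ x → run A x i Bool.≤ run A x j
distinct-after⇒≤ A L {i} {j} ij∈ m≤n after = distinct⇒≤ A (All.lookup (ordered L) ij∈) m≤n distinct
  where
  distinct : ∀ x → _ → _ → run A x i ≢ run A x j
  distinct x m≤z z≤m eq with run A x i | run A x j | comparators-∈ (run A x) (disjoint L) ij∈
  ... | true  | true  | left , _  = proj₁ (after x m≤z z≤m) left
  ... | false | false | _ , right = proj₂ (after x m≤z z≤m) right

-- Splitting a network at a layer

take-length-++ : ∀ {A : Set} (xs ys : List A) → take (length xs) (xs ++ ys) ≡ xs
take-length-++ []       ys = refl
take-length-++ (x ∷ xs) ys = cong (x ∷_) (take-length-++ xs ys)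

occursIn-++ : ∀ (A : Network n) {L B c} → c ∈ comparators L → OccursIn (A ++ L ∷ B) (suc (length A)) c
occursIn-++ []      c∈ = zero , refl , c∈
occursIn-++ (_ ∷ A) c∈ with m , eq , c∈′ ← occursIn-++ A c∈ = suc m , cong suc eq , c∈′

occursIn⇒++ : ∀ (C : Network n) {k c} → OccursIn C k c →
              ∃ λ A → ∃ λ L → ∃ λ B → C ≡ A ++ L ∷ B × k ≡ suc (length A) × c ∈ comparators L
occursIn⇒++ (L ∷ C) (zero , refl , c∈) = [] , L , C , refl , refl , c∈
occursIn⇒++ (L ∷ C) (suc m , refl , c∈) with occursIn⇒++ C (m , refl , c∈)
... | A , K , B , eq , k≡ , c∈′ = L ∷ A , K , B , cong (L ∷_) eq , cong suc k≡ , c∈′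

nonRedundant-++ : ∀ (A : Network n) {L B i j} → NonRedundant (A ++ L ∷ B) → (i , j) ∈ comparators L →
                  ¬ (∀ x → run A x i Bool.≤ run A x j)
nonRedundant-++ A {L} {B} nr ij∈ redundant = nr _ _ (occursIn-++ A ij∈) λ x →
  subst (λ D → run D x _ Bool.≤ run D x _) (sym (take-length-++ A (L ∷ B))) (redundant x)

run-∷ʳ : ∀ (A : Network n) L x → run (A ∷ʳ L) x ≡ applyLayer (run A x) L
run-∷ʳ A L x = foldl-++ applyLayer x A (L ∷ [])

-- The last layer

module _ (A : Network n) (L : Layer n) (sorting : IsSortingNetwork (A ∷ʳ L)) where

  output-sorted : ∀ x → Sorted (applyLayer (run A x) L)
  output-sorted x = subst Sorted (run-∷ʳ A L x) (sorting x)

  zeros-output : ∀ x → zeros (applyLayer (run A x) L) ≡ zeros x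
  zeros-output x = trans (cong zeros (sym (run-∷ʳ A L x))) (zeros-run (A ∷ʳ L) x)

  -- The output is sorted and has as many zeros as the input. On levels `m` and `m + 1` it is
  -- therefore 0 before channel `m` and 1 after it; only channel `m` itself varies.
  output-not-true : ∀ x {m q} → m ≤ zeros x → toℕ q < m → ¬ (applyLayer (run A x) L q ≡ true)
  output-not-true x {q = q} m≤z q<m yq =
    true≢false yq (sorted-< (output-sorted x) q
      (subst (toℕ q <_) (sym (zeros-output x)) (ℕₚ.<-≤-trans q<m m≤z)))

  output-not-false : ∀ x {m q} → zeros x ≤ suc m → m < toℕ q → ¬ (applyLayer (run A x) L q ≡ false)
  output-not-false x {q = q} z≤m m<q yq =
    true≢false (sorted-≥ (output-sorted x) q
      (subst (_≤ toℕ q) (sym (zeros-output x)) (ℕₚ.≤-trans z≤m m<q))) yq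

-- If `j` exceeded `i + 1`, then `m = i + 1` would lie strictly between the two channels, the output
-- would be 0 on `i` and 1 on `j` on both levels, and the comparator would be redundant.
last-adjacent : ∀ (A : Network n) L → IsSortingNetwork (A ∷ʳ L) → NonRedundant (A ∷ʳ L) →
                ∀ {i j} → (i , j) ∈ comparators L → toℕ j ≡ suc (toℕ i)
last-adjacent A L sorting nr {i} {j} ij∈ =
  ℕₚ.≤-antisym (ℕₚ.≮⇒≥ no-gap) (All.lookup (ordered L) ij∈)
  where
  no-gap : ¬ (suc (toℕ i) < toℕ j)
  no-gap gap = nonRedundant-++ A nr ij∈
    (distinct-after⇒≤ A L ij∈ (ℕₚ.<⇒≤ (ℕₚ.<-trans gap (toℕ<n j))) λ x m≤z z≤m →
      output-not-true A L sorting x m≤z ℕₚ.≤-refl , output-not-false A L sorting x z≤m gap)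

-- The layer before the last

singleton : ∀ {A : Set} (xs : List A) → length xs ≡ 1 → ∃ λ x → xs ≡ x ∷ []
singleton (x ∷ []) refl = x , refl

penultimate-split : ∀ {A : Set} (xs : List A) {x} ys → length (xs ++ x ∷ ys) ∸ 1 ≡ suc (length xs) →
                    ∃ λ y → ys ≡ y ∷ []
penultimate-split xs {x} ys eq
  rewrite length-++ xs {x ∷ ys} | ℕₚ.+-suc (length xs) (length ys) =
  singleton ys (ℕₚ.+-cancelˡ-≡ (length xs) _ _ (trans eq (ℕₚ.+-comm 1 (length xs))))

_∈?_ : (c : Pair n) (cs : List (Pair n)) → Dec (c ∈ cs)
_∈?_ = DecMembership._∈?_ (≡-dec Fin._≟_ Fin._≟_)

module _ (A : Network n) (K L : Layer n)
         (sorting : IsSortingNetwork (A ++ K ∷ L ∷ [])) (nr : NonRedundant (A ++ K ∷ L ∷ []))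
         {i j : Fin n} (ij∈ : (i , j) ∈ comparators K) where

  private
    C : Network n
    C = A ++ K ∷ L ∷ []

    assoc : (A ∷ʳ K) ∷ʳ L ≡ C
    assoc = ++-assoc A (K ∷ []) (L ∷ [])

    sorting′ : IsSortingNetwork ((A ∷ʳ K) ∷ʳ L)
    sorting′ = subst IsSortingNetwork (sym assoc) sorting

    occursIn-last : ∀ {c} → c ∈ comparators L → OccursIn C (length C) c
    occursIn-last {c} c∈ = subst₂ (λ D k → OccursIn D k c) assoc
      (trans (sym (trans (length-++ (A ∷ʳ K)) (ℕₚ.+-comm _ 1))) (cong length assoc))
      (occursIn-++ (A ∷ʳ K) c∈)

    adjacent : ∀ {p q} → (p , q) ∈ comparators L → toℕ q ≡ suc (toℕ p)
    adjacent = last-adjacent (A ∷ʳ K) L sorting′ (subst NonRedundant (sym assoc) nr)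

  -- A 1 on `i` after `K` would reappear in the output on `i` or its partner, hence before channel
  -- `m`, where the output is 0 on both levels. Dually a 0 on `j` would reappear after channel `m`.
  -- So `(i , j)` would be redundant.
  penultimate-no-gap : ∀ {m} → toℕ i < m → m < toℕ j →
                       (∀ q → (i , q) ∈ comparators L → toℕ q < m) →
                       (∀ q → (q , j) ∈ comparators L → m < toℕ q) → ⊥
  penultimate-no-gap {m} i<m m<j from-i to-j =
    nonRedundant-++ A nr ij∈ (distinct-after⇒≤ A K ij∈ (ℕₚ.<⇒≤ (ℕₚ.<-trans m<j (toℕ<n j))) after)
    where
    after : ∀ x → m ≤ zeros x → zeros x ≤ suc m →
            ¬ (applyLayer (run A x) K i ≡ true) × ¬ (applyLayer (run A x) K j ≡ false)
    after x m≤z z≤m rewrite sym (run-∷ʳ A K x) = not-true , not-false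
      where
      not-true : ¬ (run (A ∷ʳ K) x i ≡ true)
      not-true xi with layer-true L (run (A ∷ʳ K) x) xi
      ... | q , inj₁ refl , yq = output-not-true (A ∷ʳ K) L sorting′ x m≤z i<m yq
      ... | q , inj₂ iq∈  , yq = output-not-true (A ∷ʳ K) L sorting′ x m≤z (from-i q iq∈) yq
      not-false : ¬ (run (A ∷ʳ K) x j ≡ false)
      not-false xj with layer-false L (run (A ∷ʳ K) x) xj
      ... | q , inj₁ refl , yq = output-not-false (A ∷ʳ K) L sorting′ x z≤m m<j yq
      ... | q , inj₂ qj∈  , yq = output-not-false (A ∷ʳ K) L sorting′ x z≤m (to-j q qj∈) yq

  private
    -- By adjacency the only possible upward partner of `i` is `i + 1`, so the absence of one
    -- comparator rules out all of them. Dually, `not-partner′` concerns `j - 1`.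
    not-partner : ∀ {m} → ¬ ((i , m) ∈ comparators L) → toℕ m ≡ suc (toℕ i) →
                  ∀ {q} → ¬ ((i , q) ∈ comparators L)
    not-partner im∉ m≡ iq∈ =
      im∉ (subst (λ p → (i , p) ∈ comparators L) (toℕ-injective (trans (adjacent iq∈) (sym m≡))) iq∈)

    not-partner′ : ∀ {p} → ¬ ((p , j) ∈ comparators L) → toℕ j ≡ suc (toℕ p) →
                   ∀ {q} → ¬ ((q , j) ∈ comparators L)
    not-partner′ pj∉ j≡ qj∈ =
      pj∉ (subst (λ p → (p , j) ∈ comparators L)
        (toℕ-injective (ℕₚ.suc-injective (trans (sym (adjacent qj∈)) j≡))) qj∈)

    channel : ∀ k → toℕ i + k ≤ toℕ j → ∃ λ (m : Fin n) → toℕ m ≡ toℕ i + k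
    channel k ≤j = fromℕ< i+k<n , toℕ-fromℕ< i+k<n
      where
      i+k<n : toℕ i + k < n
      i+k<n = ℕₚ.≤-<-trans ≤j (toℕ<n j)

  penultimate-distance : toℕ j ∸ toℕ i ≤ 3
  -- Channel `i + 2` separates: a 1 from `i` gets at most to `i + 1`, a 0 from `j` at least to
  -- `j - 1`, which is beyond `i + 2` once `j` is at least `i + 4`.
  penultimate-distance = ℕₚ.≮⇒≥ λ far → penultimate-no-gap
    (ℕₚ.<-trans (ℕₚ.n<1+n _) (ℕₚ.n<1+n _))
    (ℕₚ.<-trans (ℕₚ.n<1+n _) (beyond far))
    (λ q iq∈ → s≤s (ℕₚ.≤-reflexive (adjacent iq∈)))
    (λ q qj∈ → s≤s⁻¹ (subst (4 + toℕ i ≤_) (adjacent qj∈) (beyond far)))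
    where
    beyond : 3 < toℕ j ∸ toℕ i → 3 + toℕ i < toℕ j
    beyond far = subst (4 + toℕ i ≤_) (ℕₚ.m∸n+n≡m (ℕₚ.<⇒≤ (All.lookup (ordered K) ij∈))) (ℕₚ.+-monoˡ-≤ (toℕ i) far)

  penultimate-span-2 : toℕ j ≡ toℕ i + 2 → ∃ λ m → toℕ m ≡ toℕ i + 1 ×
                       (OccursIn C (length C) (i , m) ⊎ OccursIn C (length C) (m , j))
  penultimate-span-2 j≡ with m , m≡ ← channel 1 (subst (toℕ i + 1 ≤_) (sym j≡) (ℕₚ.+-monoʳ-≤ (toℕ i) (s≤s z≤n)))
    with (i , m) ∈? comparators L | (m , j) ∈? comparators L
  ... | yes im∈ | _       = m , m≡ , inj₁ (occursIn-last im∈)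
  ... | no _    | yes mj∈ = m , m≡ , inj₂ (occursIn-last mj∈)
  -- With both comparators absent, a 1 on `i` and a 0 on `j` stay in place, and channel `i + 1`
  -- separates them.
  ... | no im∉  | no mj∉  = ⊥-elim (penultimate-no-gap
    (ℕₚ.n<1+n _)
    (ℕₚ.≤-reflexive (sym j≡2+i))
    (λ _ iq∈ → ⊥-elim (not-partner im∉ m≡1+i iq∈))
    (λ _ qj∈ → ⊥-elim (not-partner′ mj∉ (trans j≡2+i (cong suc (sym m≡1+i))) qj∈)))
    where
    m≡1+i : toℕ m ≡ 1 + toℕ i
    m≡1+i = trans m≡ (ℕₚ.+-comm (toℕ i) 1)
    j≡2+i : toℕ j ≡ 2 + toℕ i
    j≡2+i = trans j≡ (ℕₚ.+-comm (toℕ i) 2)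

  penultimate-span-3 : toℕ j ≡ toℕ i + 3 → ∃ λ m → ∃ λ p → toℕ m ≡ toℕ i + 1 × toℕ p ≡ toℕ i + 2 ×
                       OccursIn C (length C) (i , m) × OccursIn C (length C) (p , j)
  penultimate-span-3 j≡
    with m , m≡ ← channel 1 (subst (toℕ i + 1 ≤_) (sym j≡) (ℕₚ.+-monoʳ-≤ (toℕ i) (s≤s z≤n)))
       | p , p≡ ← channel 2 (subst (toℕ i + 2 ≤_) (sym j≡) (ℕₚ.+-monoʳ-≤ (toℕ i) (s≤s (s≤s z≤n))))
    with (i , m) ∈? comparators L | (p , j) ∈? comparators L
  ... | yes im∈ | yes pj∈ = m , p , m≡ , p≡ , occursIn-last im∈ , occursIn-last pj∈
  -- A 1 on `i` stays and a 0 on `j` gets no lower than `i + 2`, so channel `i + 1` separates them.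
  ... | no im∉  | _       = ⊥-elim (penultimate-no-gap
    (ℕₚ.n<1+n _)
    (ℕₚ.<-trans (ℕₚ.n<1+n _) (ℕₚ.≤-reflexive (sym j≡3+i)))
    (λ _ iq∈ → ⊥-elim (not-partner im∉ (trans m≡ (ℕₚ.+-comm (toℕ i) 1)) iq∈))
    (λ _ qj∈ → ℕₚ.≤-reflexive (ℕₚ.suc-injective (trans (sym j≡3+i) (adjacent qj∈)))))
    where
    j≡3+i : toℕ j ≡ 3 + toℕ i
    j≡3+i = trans j≡ (ℕₚ.+-comm (toℕ i) 3)
  -- Now the 0 on `j` stays and a 1 on `i` gets at most to `i + 1`, so the separating channel is
  -- `i + 2`.
  ... | yes _   | no pj∉  = ⊥-elim (penultimate-no-gap
    (ℕₚ.<-trans (ℕₚ.n<1+n _) (ℕₚ.n<1+n _))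
    (ℕₚ.≤-reflexive (sym j≡3+i))
    (λ _ iq∈ → s≤s (ℕₚ.≤-reflexive (adjacent iq∈)))
    (λ _ qj∈ → ⊥-elim (not-partner′ pj∉ (trans j≡3+i (cong suc (sym p≡2+i))) qj∈)))
    where
    j≡3+i : toℕ j ≡ 3 + toℕ i
    j≡3+i = trans j≡ (ℕₚ.+-comm (toℕ i) 3)
    p≡2+i : toℕ p ≡ 2 + toℕ i
    p≡2+i = trans p≡ (ℕₚ.+-comm (toℕ i) 2)

corollary2 : ∀ (n d : ℕ) (C : Network n) → depth C ≡ d →
    IsSortingNetwork C → NonRedundant C →
    ∀ (i j : Fin n) → OccursIn C (d ∸ 1) (i , j) →
    (toℕ j ∸ toℕ i ≤ 3)
    × (toℕ j ≡ toℕ i + 2 →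
    ∃ λ (m : Fin n) → toℕ m ≡ toℕ i + 1
    × (OccursIn C d (i , m) ⊎ OccursIn C d (m , j)))
    × (toℕ j ≡ toℕ i + 3 →
    ∃ λ (m : Fin n) → ∃ λ (p : Fin n) → toℕ m ≡ toℕ i + 1 × toℕ p ≡ toℕ i + 2
    × OccursIn C d (i , m) × OccursIn C d (p , j))
corollary2 n d C refl sorting nr i j occurs
  -- Truncated subtraction is harmless: at depth 0 or 1 the layer in question is layer 0, where
  -- nothing occurs.
  with A , K , B , refl , k≡ , ij∈ ← occursIn⇒++ C occurs
  with L , refl ← penultimate-split A B k≡ =
    penultimate-distance A K L sorting nr ij∈
  , penultimate-span-2 A K L sorting nr ij∈
  , penultimate-span-3 A K L sorting nr ij∈
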